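{- Let $q$ be a prime power and $n$ a positive integer. Let $\theta_1,\dots,\theta_n\in\mathbb{F}_{q^n}$, let $a_1,\dots,a_n\in\mathbb{F}_{q^n}$, let $m_1,\dots,m_n$ be positive integers, and let $$F(x)=a_1\mathrm{Tr}(\theta_1x)^{m_1}+\dots+a_n\mathrm{Tr}(\theta_nx)^{m_n}.$$ Then $F(x)$ is a permutation polynomial over $\mathbb{F}_{q^n}$ if and only if the following three conditions hold: (i) $\gcd(m_1\cdots m_n,q-1)=1$; (ii) $a_1,\dots,a_n$ is a basis of $\mathbb{F}_{q^n}$ over $\mathbb{F}_q$; (iii) $\theta_1,\dots,\theta_n$ is a basis of $\mathbb{F}_{q^n}$ over $\mathbb{F}_q$.
   Context: $\mathrm{Tr}(x)=x+x^q+\dots+x^{q^{n-1}}$ is the trace from $\mathbb{F}_{q^n}$ to $\mathbb{F}_q$. A polynomial in $\mathbb{F}_{q^n}[x]$ is a permutation polynomial over $\mathbb{F}_{q^n}$ if it induces a bijection of $\mathbb{F}_{q^n}$. -}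

module Defs where

open import Algebra.Bundles using (CommutativeRing; RawSemiring)
open import Algebra.Morphism.Structures using (module RingMorphisms)
import Algebra.Definitions
import Algebra.Definitions.RawMonoid
import Algebra.Definitions.RawSemiring
open import Data.Fin.Base using (Fin; toℕ)
open import Data.List.Base using (List; []; _∷_; map)
open import Data.Nat.Base as ℕ using (ℕ; zero; suc; _<_)
open import Data.Nat.Primality using (Prime)
open import Data.Product.Base using (∃; ∃₂; _×_)
open import Data.Vec.Functional using (Vector)
open import Function.Bundles using (Inverse)
open import Function.Definitions using (Bijective)
open import Level using (Level; _⊔_)
open import Relation.Binary.PropositionalEquality using (_≡_; setoid)
open import Relation.Nullary.Negation using (¬_)

private
  variable
    a b ℓ₁ ℓ₂ : Level

IsPrimePower : ℕ → Set
IsPrimePower q = ∃₂ λ p k → Prime p × 0 < k × q ≡ p ℕ.^ k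

∏ : ∀ {n} → Vector ℕ n → ℕ
∏ = Algebra.Definitions.RawSemiring.product ℕ.+-*-rawSemiring

-- The library's HeytingField carries an apartness relation as extra data.
-- Equality on a finite field is decidable, so the classical axioms suffice.
record IsField (K : CommutativeRing b ℓ₂) : Set (b ⊔ ℓ₂) where
  open CommutativeRing K
  open Algebra.Definitions _≈_ using (Invertible)
  field
    1≉0        : ¬ (1# ≈ 0#)
    invertible : ∀ {x} → ¬ (x ≈ 0#) → Invertible 1# _*_ x

-- A field with exactly N elements, counted up to the field's own equality.
record IsFiniteField (K : CommutativeRing b ℓ₂) (N : ℕ) : Set (b ⊔ ℓ₂) where
  field
    isField     : IsField K
    enumeration : Inverse (CommutativeRing.setoid K) (setoid (Fin N))

------------------------------------------------------------------------
-- K is regarded as a vector space over k along a ring homomorphism φ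
-- (necessarily injective when k and K are fields): c · x = φ c * x.

module Extension
  (k : CommutativeRing a ℓ₁) (K : CommutativeRing b ℓ₂)
  (φ : CommutativeRing.Carrier k → CommutativeRing.Carrier K)
  where

  private
    module k = CommutativeRing k
    module K = CommutativeRing K

  open Algebra.Definitions.RawMonoid K.+-rawMonoid using (sum)
  open RingMorphisms k.rawRing K.rawRing using (IsRingHomomorphism)

  IsExtension : Set (a ⊔ ℓ₁ ⊔ ℓ₂)
  IsExtension = IsRingHomomorphism φ

  linearCombination : ∀ {n} → Vector k.Carrier n → Vector K.Carrier n → K.Carrier
  linearCombination c v = sum (λ i → φ (c i) K.* v i)

  record IsBasis {n} (v : Vector K.Carrier n) : Set (a ⊔ ℓ₁ ⊔ b ⊔ ℓ₂) where
    field
      independent : ∀ c → linearCombination c v K.≈ K.0# → ∀ i → c i k.≈ k.0#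
      spanning    : ∀ x → ∃ λ c → linearCombination c v K.≈ x

------------------------------------------------------------------------
-- Univariate polynomials over K, as lists of coefficients with the
-- constant term first. Trailing zeros are permitted; equality compares
-- all coefficients.

module Polynomial (K : CommutativeRing b ℓ₂) where

  open CommutativeRing K

  Poly : Set b
  Poly = List Carrier

  coeff : Poly → ℕ → Carrier
  coeff []      _       = 0#
  coeff (c ∷ f) zero    = c
  coeff (c ∷ f) (suc i) = coeff f i

  infix 4 _≈ₚ_
  _≈ₚ_ : Poly → Poly → Set ℓ₂
  f ≈ₚ g = ∀ i → coeff f i ≈ coeff g i

  infixl 6 _+ₚ_
  _+ₚ_ : Poly → Poly → Poly
  []      +ₚ g       = g
  (c ∷ f) +ₚ []      = c ∷ f
  (c ∷ f) +ₚ (d ∷ g) = (c + d) ∷ (f +ₚ g)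

  infixl 7 _*ₚ_
  _*ₚ_ : Poly → Poly → Poly
  []      *ₚ g = []
  (c ∷ f) *ₚ g = map (c *_) g +ₚ (0# ∷ (f *ₚ g))

  const : Carrier → Poly
  const c = c ∷ []

  X : Poly
  X = 0# ∷ 1# ∷ []

  polyRawSemiring : RawSemiring b ℓ₂
  polyRawSemiring = record
    { Carrier = Poly
    ; _≈_     = _≈ₚ_
    ; _+_     = _+ₚ_
    ; _*_     = _*ₚ_
    ; 0#      = []
    ; 1#      = const 1#
    }

  open Algebra.Definitions.RawSemiring polyRawSemiring public
    using () renaming (sum to ∑ₚ; _^_ to _^ₚ_)

  eval : Poly → Carrier → Carrier
  eval []      x = 0#
  eval (c ∷ f) x = c + x * eval f x

  IsPermutationPolynomial : Poly → Set (b ⊔ ℓ₂)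
  IsPermutationPolynomial f = Bijective _≈_ _≈_ (eval f)

  -- Tr q n f = f + f^q + … + f^(q^(n-1)), for a polynomial f.
  Tr : ℕ → ℕ → Poly → Poly
  Tr q n f = ∑ₚ {n} (λ j → f ^ₚ (q ℕ.^ toℕ j))

  -- a₁ Tr(θ₁ X)^m₁ + … + aₙ Tr(θₙ X)^mₙ
  traceForm : (q n : ℕ) (a θ : Vector Carrier n) (m : Vector ℕ n) → Poly
  traceForm q n a θ m =
    ∑ₚ (λ i → const (a i) *ₚ (Tr q n (const (θ i) *ₚ X) ^ₚ m i))

{-# OPTIONS --safe #-}
module Submission where

-- By Frobenius additivity and Fermat, Tr(x)^q = Tr(x), so Tr takes values among the roots
-- φ(𝔽q) of X^q − X, and F is the composite of τ : x ↦ (Tr(θᵢx))ᵢ, the powers c ↦ (cᵢ^mᵢ)ᵢ on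
-- (𝔽q)ⁿ, and c ↦ ∑ cᵢαᵢ. All sets involved have qⁿ elements, so F is bijective iff each of the
-- three maps is. The last one is bijective iff α is a basis. The powers are injective
-- when gcd(∏ mᵢ, q − 1) = 1 by Bézout, and surjectivity forces this since otherwise a polynomial
-- X^(e+1) − X with e + 1 < q has q roots. Finally τ is bijective iff θ is a basis, because Tr
-- has degree q^(n−1) < qⁿ and hence is not identically zero.

open import Defs
open import Algebra.Bundles using (CommutativeRing)
open import Algebra.Morphism.Structures using (module RingMorphisms)
import Algebra.Properties.AbelianGroup as AbelianGroupProperties
import Algebra.Properties.CommutativeMonoid.Sum as MonoidSum
import Algebra.Properties.CommutativeSemiring.Binomial as Binomial
import Algebra.Properties.CommutativeSemiring.Exp as Exp
import Algebra.Properties.Ring as RingProperties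
import Algebra.Properties.Semiring.Mult as Mult
import Algebra.Properties.Semiring.Sum as SemiringSum
import Algebra.Solver.Ring.NaturalCoefficients.Default as SemiringSolver
open import Data.Empty using (⊥-elim)
open import Data.Fin.Base as Fin using (Fin; zero; suc; toℕ; fromℕ; inject₁)
open import Data.Fin.Permutation using (Permutation; permutation; _⟨$⟩ʳ_)
import Data.Fin.Properties as Fin
open import Data.List.Base using ([]; _∷_; map)
open import Data.Nat.Base as ℕ using (ℕ; zero; suc; _<_; _≤_; _∸_; _^_; _!; z≤n; s≤s)
open import Data.Nat.Combinatorics using (_C_; nCn≡1; nCk≡n!/k![n-k]!; k![n∸k]!∣n!)
open import Data.Nat.Divisibility using (_∣_; divides; ∣⇒≤; m∣m*n; ∣n⇒∣m*n)
open import Data.Nat.DivMod using (m/n*n≡m)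
open import Data.Nat.GCD using (gcd; GCD; module Bézout; gcd-GCD; gcd[m,n]∣m; gcd[m,n]∣n)
open import Data.Nat.Primality using (Prime; euclidsLemma; prime⇒nonZero; prime⇒nonTrivial)
import Data.Nat.Properties as ℕ
open import Data.Product.Base using (∃; _×_; _,_; proj₁; proj₂)
open import Data.Sum.Base using (_⊎_; inj₁; inj₂; [_,_]′)
open import Data.Vec.Functional as Vector using (Vector)
open import Data.Vec.Functional.Properties using (updateAt-updates; updateAt-minimal)
import Data.Vec.Functional.Relation.Binary.Equality.Setoid as VectorEquality
open import Function.Base using (_∘_)
open import Function.Bundles using (_⇔_; mk⇔; Inverse)
import Function.Construct.Identity as Identity
import Function.Consequences.Setoid as Consequences
open import Function.Definitions using (Congruent; Injective; StrictlySurjective)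
open import Function.Properties.Inverse using (Inverse⇒Injection)
open import Level using (Level; _⊔_)
open import Relation.Binary.Bundles using (Setoid)
open import Relation.Binary.Definitions using (Decidable)
open import Relation.Binary.PropositionalEquality as ≡ using (_≡_; _≢_)
import Relation.Binary.Reasoning.Setoid as SetoidReasoning
open import Relation.Nullary using (¬_; yes; no; contradiction)
open import Relation.Nullary.Decidable using (via-injection)

-- By itself, bijectivity of a composite of three maps gives only that the first is injective and
-- the last surjective. Since all the sets have the same finite size, these two maps are then
-- bijective, and the middle one inherits surjectivity. The same equality of sizes makes spanning
-- alone, or independence alone, enough for `n` vectors to form a basis. Roots are counted three
-- times: to see that the solutions of x^q = x in `K` come from `k`, to obtain the gcd condition,
-- and to see that the trace is not identically zero. All three counts rest on `top≈0`. That Tr is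
-- not identically zero suffices for (iii) because the pairing Tr(zx) can be rescaled: if it
-- vanishes for all z in the span of the θᵢ, and they span `K`, then Tr vanishes on the multiples of
-- x, which are all of `K` unless x = 0.

private
  variable
    a b ℓ₁ ℓ₂ : Level

-- Finite setoids

Enumeration : Setoid a ℓ₁ → ℕ → Set _
Enumeration A N = Inverse A (≡.setoid (Fin N))

module _ {A : Setoid a ℓ₁} {N : ℕ} (enum : Enumeration A N) where
  open Setoid A
  open Inverse enum

  enumerate-injective : ∀ {i j} → from i ≈ from j → i ≡ j
  enumerate-injective {i} {j} eq =
    ≡.trans (≡.sym (strictlyInverseˡ i)) (≡.trans (to-cong eq) (strictlyInverseˡ j))

  index-injective : ∀ {x y} → to x ≡ to y → x ≈ y
  index-injective {x} {y} eq =
    trans (sym (strictlyInverseʳ x)) (trans (from-cong eq) (strictlyInverseʳ y))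

  ≈-decidable : Decidable _≈_
  ≈-decidable = via-injection (Inverse⇒Injection enum) Fin._≟_

  permute : (f g : Carrier → Carrier) → Congruent _≈_ _≈_ f → Congruent _≈_ _≈_ g →
            (∀ x → f (g x) ≈ x) → (∀ x → g (f x) ≈ x) → Permutation N N
  permute f g f-cong g-cong fg gf = permutation (to ∘ f ∘ from) (to ∘ g ∘ from)
    (λ i → ≡.trans (to-cong (trans (f-cong (strictlyInverseʳ _)) (fg _))) (strictlyInverseˡ i))
    (λ i → ≡.trans (to-cong (trans (g-cong (strictlyInverseʳ _)) (gf _))) (strictlyInverseˡ i))

module _ {A : Setoid a ℓ₁} {B : Setoid b ℓ₂} {N : ℕ}
         (enumA : Enumeration A N) (enumB : Enumeration B N) where
  private
    module A = Setoid A
    module B = Setoid B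
    module EA = Inverse enumA
    module EB = Inverse enumB

  -- If `y` were missed, listing `y` in front of the values of `f` would inject `Fin (suc N)` into
  -- `Fin N`. The search for a preimage is decidable, so the argument is constructive.
  injective⇒strictlySurjective : {f : A.Carrier → B.Carrier} →
    Injective A._≈_ B._≈_ f → StrictlySurjective B._≈_ f
  injective⇒strictlySurjective {f} inj y
    with Fin.any? (λ i → EB.to (f (EA.from i)) Fin.≟ EB.to y)
  ... | yes (i , eq) = EA.from i , index-injective enumB eq
  ... | no ∄i = ⊥-elim (Fin.<⇒notInjective (ℕ.n<1+n N) g-injective)
    where
    g : Fin (suc N) → Fin N
    g zero    = EB.to y
    g (suc i) = EB.to (f (EA.from i))
    g-injective : Injective _≡_ _≡_ g
    g-injective {zero}  {zero}  _  = ≡.refl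
    g-injective {zero}  {suc j} eq = contradiction (j , ≡.sym eq) ∄i
    g-injective {suc i} {zero}  eq = contradiction (i , eq) ∄i
    g-injective {suc i} {suc j} eq =
      ≡.cong suc (enumerate-injective enumA (inj (index-injective enumB eq)))

module _ {A : Setoid a ℓ₁} {B : Setoid b ℓ₂} {N : ℕ}
         (enumA : Enumeration A N) (enumB : Enumeration B N) where
  private
    module A = Setoid A
    module B = Setoid B
    module EB = Inverse enumB

  -- A section of `f` is injective, hence surjective by the previous count. So `x` and `x′` are both
  -- values of the section, and `f` recovers the index of such a value.
  strictlySurjective⇒injective : {f : A.Carrier → B.Carrier} → Congruent A._≈_ B._≈_ f →
    StrictlySurjective B._≈_ f → Injective A._≈_ B._≈_ f
  strictlySurjective⇒injective {f} f-cong surj {x} {x′} fx≈fx′ =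
    A.trans (A.sym si≈x) (A.trans (A.reflexive (≡.cong section i≡j)) sj≈x′)
    where
    section : Fin N → A.Carrier
    section i = proj₁ (surj (EB.from i))
    f-section : ∀ i → f (section i) B.≈ EB.from i
    f-section i = proj₂ (surj (EB.from i))
    section-surjective : StrictlySurjective A._≈_ section
    section-surjective = injective⇒strictlySurjective (Identity.inverse (≡.setoid (Fin N))) enumA
      λ {i} {j} eq → enumerate-injective enumB
        (B.trans (B.sym (f-section i)) (B.trans (f-cong eq) (f-section j)))
    i = proj₁ (section-surjective x)
    j = proj₁ (section-surjective x′)
    si≈x  = proj₂ (section-surjective x)
    sj≈x′ = proj₂ (section-surjective x′)
    i≡j : i ≡ j
    i≡j = enumerate-injective enumB
      (B.trans (B.sym (f-section i)) (B.trans (f-cong si≈x) (B.trans fx≈fx′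
        (B.trans (f-cong (A.sym sj≈x′)) (f-section j)))))

funToFin-cong : ∀ {m n} {f g : Fin m → Fin n} → (∀ i → f i ≡ g i) →
                Fin.funToFin f ≡ Fin.funToFin g
funToFin-cong {zero}  eq = ≡.refl
funToFin-cong {suc m} eq = ≡.cong₂ Fin.combine (eq zero) (funToFin-cong (eq ∘ suc))

vectorEnumeration : {A : Setoid a ℓ₁} {N : ℕ} → Enumeration A N →
                    ∀ n → Enumeration (VectorEquality.≋-setoid A n) (N ^ n)
vectorEnumeration {A = A} {N} enum n = record
  { to        = λ v → Fin.funToFin (to ∘ v)
  ; from      = λ i → from ∘ Fin.finToFun {N} {n} i
  ; to-cong   = λ eq → funToFin-cong (to-cong ∘ eq)
  ; from-cong = λ { ≡.refl i → refl }
  ; inverse   = (λ {x} {v} v≈ → ≡.trans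
                    (funToFin-cong (λ i → ≡.trans (to-cong (v≈ i)) (strictlyInverseˡ _)))
                    (Fin.funToFin-finToFin {n} {N} x))
              , λ { {v} ≡.refl i → trans (from-cong (Fin.finToFun-funToFin (to ∘ v) i))
                                         (strictlyInverseʳ (v i)) }
  }
  where
  open Setoid A
  open Inverse enum

-- Binomial coefficients modulo a prime

prime∤! : ∀ {p} → Prime p → ∀ k → k < p → ¬ p ∣ k !
prime∤! pr zero    0<p p∣1 = ℕ.<⇒≱ (ℕ.nonTrivial⇒n>1 _ {{prime⇒nonTrivial pr}}) (∣⇒≤ p∣1)
prime∤! pr (suc k) k<p p∣  with euclidsLemma (suc k) (k !) pr p∣
... | inj₁ p∣1+k = ℕ.<⇒≱ k<p (∣⇒≤ p∣1+k)
... | inj₂ p∣k!  = prime∤! pr k (ℕ.<-trans (ℕ.n<1+n k) k<p) p∣k!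

-- The prime divides p! = C(p,k) k! (p-k)!, but neither factorial, since all their factors are
-- smaller than p.
prime∣C : ∀ {p} → Prime p → ∀ k → 0 < k → k < p → p ∣ p C k
prime∣C {p@(suc p-1)} pr k 0<k k<p =
  [ (λ p∣C → p∣C)
  , (λ p∣k![p∸k]! → ⊥-elim ([ prime∤! pr k k<p , prime∤! pr (p ∸ k) (ℕ.∸-monoʳ-< 0<k (ℕ.<⇒≤ k<p)) ]′
                              (euclidsLemma (k !) ((p ∸ k) !) pr p∣k![p∸k]!)))
  ]′ (euclidsLemma (p C k) (k ! ℕ.* (p ∸ k) !) pr p∣product)
  where
  instance
    _ = ℕ._!*_!≢0 k (p ∸ k)
  product≡p! : (p C k) ℕ.* (k ! ℕ.* (p ∸ k) !) ≡ p !
  product≡p! = ≡.trans (≡.cong (ℕ._* (k ! ℕ.* (p ∸ k) !)) (nCk≡n!/k![n-k]! (ℕ.<⇒≤ k<p)))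
                       (m/n*n≡m (k![n∸k]!∣n! (ℕ.<⇒≤ k<p)))
  p∣product : p ∣ (p C k) ℕ.* (k ! ℕ.* (p ∸ k) !)
  p∣product = ≡.subst (p ∣_) (≡.sym product≡p!) (m∣m*n (p-1 !))

-- Polynomial functions

module PolynomialFunctions (R : CommutativeRing a ℓ₁) where
  open CommutativeRing R hiding (zero)
  open SemiringSum semiring using (sum; sum-cong-≋)
  open Exp commutativeSemiring renaming (_^_ to _^ᴿ_)
  open Polynomial R
  open SetoidReasoning setoid
  open SemiringSolver commutativeSemiring using (solve; _:+_; _:*_; _:=_)

  eval-cong : ∀ f {x y} → x ≈ y → eval f x ≈ eval f y
  eval-cong []      x≈y = refl
  eval-cong (c ∷ f) x≈y = +-congˡ (*-cong x≈y (eval-cong f x≈y))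

  eval-const : ∀ c x → eval (const c) x ≈ c
  eval-const c x = trans (+-congˡ (zeroʳ x)) (+-identityʳ c)

  eval-X : ∀ x → eval X x ≈ x
  eval-X x = begin
    0# + x * (1# + x * 0#) ≈⟨ +-identityˡ _ ⟩
    x * (1# + x * 0#)      ≈⟨ *-congˡ (eval-const 1# x) ⟩
    x * 1#                 ≈⟨ *-identityʳ x ⟩
    x                      ∎

  eval-+ : ∀ f g x → eval (f +ₚ g) x ≈ eval f x + eval g x
  eval-+ []      g       x = sym (+-identityˡ _)
  eval-+ (c ∷ f) []      x = sym (+-identityʳ _)
  eval-+ (c ∷ f) (d ∷ g) x = begin
    (c + d) + x * eval (f +ₚ g) x            ≈⟨ +-congˡ (*-congˡ (eval-+ f g x)) ⟩
    (c + d) + x * (eval f x + eval g x)      ≈⟨ solve 5 (λ c d x u v → (c :+ d) :+ x :* (u :+ v)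
                                                  := (c :+ x :* u) :+ (d :+ x :* v)) refl c d x _ _ ⟩
    (c + x * eval f x) + (d + x * eval g x)  ∎

  eval-scale : ∀ c f x → eval (map (c *_) f) x ≈ c * eval f x
  eval-scale c []      x = sym (zeroʳ c)
  eval-scale c (d ∷ f) x = begin
    c * d + x * eval (map (c *_) f) x ≈⟨ +-congˡ (*-congˡ (eval-scale c f x)) ⟩
    c * d + x * (c * eval f x)        ≈⟨ solve 4 (λ c d x u → c :* d :+ x :* (c :* u)
                                             := c :* (d :+ x :* u)) refl c d x _ ⟩
    c * (d + x * eval f x)            ∎

  eval-* : ∀ f g x → eval (f *ₚ g) x ≈ eval f x * eval g x
  eval-* []      g x = sym (zeroˡ _)
  eval-* (c ∷ f) g x = begin
    eval (map (c *_) g +ₚ (0# ∷ (f *ₚ g))) x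
      ≈⟨ eval-+ (map (c *_) g) _ x ⟩
    eval (map (c *_) g) x + (0# + x * eval (f *ₚ g) x)
      ≈⟨ +-cong (eval-scale c g x) (trans (+-identityˡ _) (*-congˡ (eval-* f g x))) ⟩
    c * eval g x + x * (eval f x * eval g x)
      ≈⟨ solve 4 (λ c x u v → c :* v :+ x :* (u :* v) := (c :+ x :* u) :* v) refl c x _ _ ⟩
    (c + x * eval f x) * eval g x ∎

  eval-^ : ∀ f n x → eval (f ^ₚ n) x ≈ eval f x ^ᴿ n
  eval-^ f zero    x = eval-const 1# x
  eval-^ f (suc n) x = trans (eval-* f (f ^ₚ n) x) (*-congˡ (eval-^ f n x))

  eval-∑ : ∀ {n} (f : Vector Poly n) x → eval (∑ₚ f) x ≈ sum (λ i → eval (f i) x)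
  eval-∑ {zero}  f x = refl
  eval-∑ {suc n} f x = trans (eval-+ (f zero) (∑ₚ (f ∘ suc)) x) (+-congˡ (eval-∑ (f ∘ suc) x))

  eval-Tr : ∀ q n f x → eval (Tr q n f) x ≈ sum {n} (λ j → eval f x ^ᴿ (q ^ toℕ j))
  eval-Tr q n f x = trans (eval-∑ {n} (λ j → f ^ₚ (q ^ toℕ j)) x)
    (sum-cong-≋ {n} (λ j → eval-^ f (q ^ toℕ j) x))

  eval-traceForm : ∀ q n (α θ : Vector Carrier n) (m : Vector ℕ n) x →
    eval (traceForm q n α θ m) x ≈
      sum (λ i → α i * sum {n} (λ j → (θ i * x) ^ᴿ (q ^ toℕ j)) ^ᴿ m i)
  eval-traceForm q n α θ m x = trans (eval-∑ {n} (λ i → const (α i) *ₚ (Trθ i ^ₚ m i)) x)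
    (sum-cong-≋ {n} (λ i → begin
      eval (const (α i) *ₚ (Trθ i ^ₚ m i)) x
        ≈⟨ eval-* (const (α i)) (Trθ i ^ₚ m i) x ⟩
      eval (const (α i)) x * eval (Trθ i ^ₚ m i) x
        ≈⟨ *-cong (eval-const (α i) x) (trans (eval-^ (Trθ i) (m i) x) (^-congˡ (m i) (begin
             eval (Trθ i) x
               ≈⟨ eval-Tr q n (const (θ i) *ₚ X) x ⟩
             sum {n} (λ j → eval (const (θ i) *ₚ X) x ^ᴿ (q ^ toℕ j))
               ≈⟨ sum-cong-≋ {n} (λ j → ^-congˡ (q ^ toℕ j) (trans (eval-* (const (θ i)) X x)
                    (*-cong (eval-const (θ i) x) (eval-X x)))) ⟩
             sum {n} (λ j → (θ i * x) ^ᴿ (q ^ toℕ j)) ∎))) ⟩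
      α i * sum {n} (λ j → (θ i * x) ^ᴿ (q ^ toℕ j)) ^ᴿ m i ∎))
    where
    Trθ : Fin n → Poly
    Trθ i = Tr q n (const (θ i) *ₚ X)

  -- f is given by a polynomial of degree at most d whose coefficient of x^d is l.
  data HasTop : ℕ → Carrier → (Carrier → Carrier) → Set (a ⊔ ℓ₁) where
    constant : ∀ {l f} → (∀ x → f x ≈ l) → HasTop 0 l f
    horner   : ∀ {d l c f} g → HasTop d l g → (∀ x → f x ≈ x * g x + c) → HasTop (suc d) l f

  hasTop-resp : ∀ {d l l′ f g} → l ≈ l′ → (∀ x → f x ≈ g x) → HasTop d l f → HasTop d l′ g
  hasTop-resp l≈l′ f≈g (constant f≈l)  = constant (λ x → trans (sym (f≈g x)) (trans (f≈l x) l≈l′))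
  hasTop-resp l≈l′ f≈g (horner h H f≈) =
    horner h (hasTop-resp l≈l′ (λ _ → refl) H) (λ x → trans (sym (f≈g x)) (f≈ x))

  hasTop-+ : ∀ {d l l′ f g} → HasTop d l f → HasTop d l′ g → HasTop d (l + l′) (λ x → f x + g x)
  hasTop-+ (constant f≈l)  (constant g≈l′)   = constant (λ x → +-cong (f≈l x) (g≈l′ x))
  hasTop-+ (horner {c = c} h H f≈) (horner {c = c′} h′ H′ g≈) =
    horner (λ x → h x + h′ x) (hasTop-+ H H′) λ x → trans (+-cong (f≈ x) (g≈ x))
      (solve 5 (λ x u c v c′ → (x :* u :+ c) :+ (x :* v :+ c′) := x :* (u :+ v) :+ (c :+ c′))
        refl x _ c _ c′)

  -- The degree is only an upper bound, so a term may be padded with a zero leading coefficient.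
  -- This brings summands to the common degree that `hasTop-+` requires.
  hasTop-suc : ∀ {d l f} → HasTop d l f → HasTop (suc d) 0# f
  hasTop-suc (constant f≈l)  = horner (λ _ → 0#) (constant (λ _ → refl))
    λ x → trans (f≈l x) (trans (sym (+-identityˡ _)) (+-congʳ (sym (zeroʳ x))))
  hasTop-suc (horner g G f≈) = horner g (hasTop-suc G) f≈

  hasTop-< : ∀ {d e l f} → d < e → HasTop d l f → HasTop e 0# f
  hasTop-< {e = suc e} d<1+e H with ℕ.m<1+n⇒m<n∨m≡n d<1+e
  ... | inj₁ d<e    = hasTop-suc (hasTop-< d<e H)
  ... | inj₂ ≡.refl = hasTop-suc H

  hasTop-^ : ∀ d → HasTop d 1# (_^ᴿ d)
  hasTop-^ zero    = constant (λ _ → refl)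
  hasTop-^ (suc d) = horner (_^ᴿ d) (hasTop-^ d) (λ _ → sym (+-identityʳ _))

  hasTop-sum : ∀ {d n} (f : Fin n → Carrier → Carrier) → (∀ i → HasTop d 0# (f i)) →
               HasTop d 0# (λ x → sum (λ i → f i x))
  hasTop-sum {zero}  {zero}  f H = constant (λ _ → refl)
  hasTop-sum {suc d} {zero}  f H = hasTop-< ℕ.z<s (constant {l = 0#} (λ _ → refl))
  hasTop-sum {d}     {suc n} f H =
    hasTop-resp (+-identityʳ 0#) (λ _ → refl) (hasTop-+ (H zero) (hasTop-sum (f ∘ suc) (H ∘ suc)))

  -- The division f(x) − f(r) = (x − r) h(x), without subtraction.
  divide : ∀ {d l f} → HasTop (suc d) l f → ∀ r →
           ∃ λ h → HasTop d l h × (∀ x → f x + r * h x ≈ x * h x + f r)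
  divide {l = l} (horner {c = c} g (constant g≈l) f≈) r =
    (λ _ → l) , constant (λ _ → refl) , λ x → begin
      _                         ≈⟨ +-congʳ (trans (f≈ x) (+-congʳ (*-congˡ (g≈l x)))) ⟩
      (x * l + c) + r * l       ≈⟨ solve 4 (λ x l c r → (x :* l :+ c) :+ r :* l
                                     := x :* l :+ (r :* l :+ c)) refl x l c r ⟩
      x * l + (r * l + c)       ≈⟨ +-congˡ (trans (f≈ r) (+-congʳ (*-congˡ (g≈l r)))) ⟨
      _                         ∎
  divide {f = f} (horner {c = c} g G@(horner _ _ _) f≈) r with divide G r
  ... | h , H , g≈ = (λ x → x * h x + g r) , horner h H (λ _ → refl) , λ x → begin
      f x + r * (x * h x + g r)           ≈⟨ +-congʳ (f≈ x) ⟩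
      (x * g x + c) + r * (x * h x + g r) ≈⟨ solve 6 (λ x gx c r hx gr →
                                               (x :* gx :+ c) :+ r :* (x :* hx :+ gr)
                                               := x :* (gx :+ r :* hx) :+ (r :* gr :+ c))
                                               refl x (g x) c r (h x) (g r) ⟩
      x * (g x + r * h x) + (r * g r + c) ≈⟨ +-cong (*-congˡ (g≈ x)) (sym (f≈ r)) ⟩
      x * (x * h x + g r) + f r           ∎

-- Additivity of the Frobenius map

module Characteristic (R : CommutativeRing a ℓ₁) where
  open CommutativeRing R hiding (zero)
  open SemiringSum semiring using (sum; sum-cong-≋; sum-init-last; sum-replicate-zero)
  open Exp commutativeSemiring renaming (_^_ to _^ᴿ_)
  open Mult semiring renaming (_×_ to _·_) using (×-assoc-*; ×-assocˡ; ×-congʳ; ×-congˡ; ×-homo-1)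
  open Binomial commutativeSemiring using (binomialTerm; theorem)
  open SetoidReasoning setoid

  module _ {p} (prime : Prime p) (p·1≈0 : p · 1# ≈ 0#) where

    multiple-vanishes : ∀ {m} → p ∣ m → ∀ x → m · x ≈ 0#
    multiple-vanishes (divides d ≡.refl) x = begin
      (d ℕ.* p) · x    ≈⟨ ×-congˡ (ℕ.*-comm d p) ⟩
      (p ℕ.* d) · x    ≈⟨ ×-assocˡ x p d ⟨
      p · (d · x)      ≈⟨ ×-congʳ p (*-identityˡ _) ⟨
      p · (1# * d · x) ≈⟨ ×-assoc-* p 1# _ ⟨
      p · 1# * d · x   ≈⟨ *-congʳ p·1≈0 ⟩
      0# * d · x       ≈⟨ zeroˡ _ ⟩
      0#               ∎

    frobenius-+ : ∀ x y → (x + y) ^ᴿ p ≈ x ^ᴿ p + y ^ᴿ p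
    frobenius-+ x y = expand p ≡.refl
      where
      -- Matching on a fresh `p′` exposes p as a successor, so that both the first and the last term
      -- of the binomial sum can be split off.
      expand : ∀ p′ → p ≡ p′ → (x + y) ^ᴿ p′ ≈ x ^ᴿ p′ + y ^ᴿ p′
      expand zero ≡.refl = ⊥-elim (ℕ.≢-nonZero⁻¹ 0 {{prime⇒nonZero prime}} ≡.refl)
      expand (suc p-1) ≡.refl = begin
        (x + y) ^ᴿ p                       ≈⟨ theorem p x y ⟩
        sum (binomialTerm x y p)           ≡⟨⟩
        binomialTerm x y p zero + sum (binomialTerm x y p ∘ suc)
          ≈⟨ +-cong first (trans (sum-init-last (binomialTerm x y p ∘ suc)) (+-cong inner last)) ⟩
        y ^ᴿ p + (0# + x ^ᴿ p)             ≈⟨ +-congˡ (+-identityˡ _) ⟩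
        y ^ᴿ p + x ^ᴿ p                    ≈⟨ +-comm _ _ ⟩
        x ^ᴿ p + y ^ᴿ p                    ∎
        where
        first : binomialTerm x y p zero ≈ y ^ᴿ p
        first = trans (×-homo-1 _) (*-identityˡ _)
        -- The shift by `suc` omits index 0 and `init` omits index p, so every remaining binomial
        -- coefficient is divisible by p.
        inner : sum (Vector.init (binomialTerm x y p ∘ suc)) ≈ 0#
        inner = trans (sum-cong-≋ {p-1} λ i → multiple-vanishes
                        (prime∣C prime _ ℕ.z<s (s≤s (≡.subst (_< p-1) (≡.sym (Fin.toℕ-inject₁ i)) (Fin.toℕ<n i)))) _)
                      (sum-replicate-zero p-1)
        last : binomialTerm x y p (suc (fromℕ p-1)) ≈ x ^ᴿ p
        last = begin
          binomialTerm x y p (suc (fromℕ p-1))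
            ≡⟨ ≡.cong (λ k → (p C suc k) · (x ^ᴿ suc k * y ^ᴿ (p-1 ∸ k))) (Fin.toℕ-fromℕ p-1) ⟩
          (p C p) · (x ^ᴿ p * y ^ᴿ (p ∸ p)) ≈⟨ ×-congˡ (nCn≡1 p) ⟩
          1 · (x ^ᴿ p * y ^ᴿ (p ∸ p))       ≈⟨ ×-homo-1 _ ⟩
          x ^ᴿ p * y ^ᴿ (p ∸ p)             ≈⟨ *-congˡ (^-congʳ y (ℕ.n∸n≡0 p)) ⟩
          x ^ᴿ p * 1#                       ≈⟨ *-identityʳ _ ⟩
          x ^ᴿ p                            ∎

    frobenius^-+ : ∀ e x y → (x + y) ^ᴿ (p ^ e) ≈ x ^ᴿ (p ^ e) + y ^ᴿ (p ^ e)
    frobenius^-+ zero    x y = trans (*-identityʳ _) (sym (+-cong (*-identityʳ x) (*-identityʳ y)))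
    frobenius^-+ (suc e) x y = begin
      (x + y) ^ᴿ (p ℕ.* p ^ e)                     ≈⟨ ^-assocʳ (x + y) p (p ^ e) ⟨
      ((x + y) ^ᴿ p) ^ᴿ (p ^ e)                    ≈⟨ ^-congˡ (p ^ e) (frobenius-+ x y) ⟩
      (x ^ᴿ p + y ^ᴿ p) ^ᴿ (p ^ e)                 ≈⟨ frobenius^-+ e _ _ ⟩
      (x ^ᴿ p) ^ᴿ (p ^ e) + (y ^ᴿ p) ^ᴿ (p ^ e)    ≈⟨ +-cong (^-assocʳ x p (p ^ e)) (^-assocʳ y p (p ^ e)) ⟩
      x ^ᴿ (p ℕ.* p ^ e) + y ^ᴿ (p ℕ.* p ^ e)      ∎

-- Finite fields

module FiniteField (K : CommutativeRing a ℓ₁) {N : ℕ} (finite : IsFiniteField K N) where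
  open CommutativeRing K hiding (zero)
  open IsFiniteField finite
  open IsField isField
  open Inverse enumeration
  open Exp commutativeSemiring renaming (_^_ to _^ᴷ_)
  open Mult semiring renaming (_×_ to _·_) using (×1-homo-*; ×-congˡ; ×-homo-1)
  open PolynomialFunctions K using (HasTop; constant; horner; hasTop-+; hasTop-^; hasTop-<; hasTop-resp; divide)
  open SetoidReasoning setoid
  open SemiringSolver commutativeSemiring using (solve; _:*_; _:=_)
  private
    module ∑ = MonoidSum +-commutativeMonoid
    module ∏ = MonoidSum *-commutativeMonoid

  infix 4 _≟_
  _≟_ : Decidable _≈_
  _≟_ = ≈-decidable enumeration

  *-cancelʳ-nonZero : ∀ {x y z} → ¬ z ≈ 0# → x * z ≈ y * z → x ≈ y
  *-cancelʳ-nonZero {x} {y} {z} z≉0 xz≈yz with invertible z≉0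
  ... | z⁻¹ , _ , zz⁻¹≈1 = begin
    x             ≈⟨ *-identityʳ x ⟨
    x * 1#        ≈⟨ *-congˡ zz⁻¹≈1 ⟨
    x * (z * z⁻¹) ≈⟨ *-assoc x z z⁻¹ ⟨
    x * z * z⁻¹   ≈⟨ *-congʳ xz≈yz ⟩
    y * z * z⁻¹   ≈⟨ *-assoc y z z⁻¹ ⟩
    y * (z * z⁻¹) ≈⟨ *-congˡ zz⁻¹≈1 ⟩
    y * 1#        ≈⟨ *-identityʳ y ⟩
    y             ∎

  x*y≈0⇒x≈0∨y≈0 : ∀ {x y} → x * y ≈ 0# → x ≈ 0# ⊎ y ≈ 0#
  x*y≈0⇒x≈0∨y≈0 {x} {y} xy≈0 with y ≟ 0#
  ... | yes y≈0 = inj₂ y≈0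
  ... | no  y≉0 = inj₁ (*-cancelʳ-nonZero y≉0 (trans xy≈0 (sym (zeroˡ y))))

  x^n≈0⇒x≈0 : ∀ n {x} → x ^ᴷ n ≈ 0# → x ≈ 0#
  x^n≈0⇒x≈0 zero    1≈0 = contradiction 1≈0 1≉0
  x^n≈0⇒x≈0 (suc n) eq  = [ (λ x≈0 → x≈0) , x^n≈0⇒x≈0 n ]′ (x*y≈0⇒x≈0∨y≈0 eq)

  0^n≈0 : ∀ n → 0 < n → 0# ^ᴷ n ≈ 0#
  0^n≈0 (suc n) _ = zeroˡ _

  1^n≈1 : ∀ n → 1# ^ᴷ n ≈ 1#
  1^n≈1 zero    = refl
  1^n≈1 (suc n) = trans (*-identityˡ _) (1^n≈1 n)

  1<N : 1 < N
  1<N = at-least-two (to 0#) (to 1#) (λ eq → 1≉0 (sym (index-injective enumeration eq)))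
    where
    at-least-two : ∀ {n} (i j : Fin n) → i ≢ j → 1 < n
    at-least-two {suc zero}    zero zero i≢j = contradiction ≡.refl i≢j
    at-least-two {suc (suc n)} _    _    _   = s≤s (s≤s z≤n)

  1+[N∸1]≡N : suc (N ∸ 1) ≡ N
  1+[N∸1]≡N = ℕ.m+[n∸m]≡n (ℕ.<⇒≤ 1<N)

  -- Translation by 1 permutes the field, so the sum S of all elements satisfies N · 1 + S = S.
  N·1≈0 : N · 1# ≈ 0#
  N·1≈0 = identityˡ-unique _ _ (begin
    N · 1# + ∑.sum from                        ≈⟨ +-congʳ (∑.sum-replicate N) ⟨
    ∑.sum (Vector.replicate N 1#) + ∑.sum from ≈⟨ ∑.∑-distrib-+ (Vector.replicate N 1#) from ⟨
    ∑.sum (λ i → 1# + from i)                  ≈⟨ ∑.sum-cong-≋ (λ i → strictlyInverseʳ (1# + from i)) ⟨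
    ∑.sum (λ i → from (π ⟨$⟩ʳ i))              ≈⟨ ∑.sum-permute from π ⟨
    ∑.sum from                                 ∎)
    where
    open AbelianGroupProperties +-abelianGroup using (identityˡ-unique)
    cancel : ∀ {y z} → y + z ≈ 0# → ∀ w → y + (z + w) ≈ w
    cancel y+z≈0 w = trans (sym (+-assoc _ _ _)) (trans (+-congʳ y+z≈0) (+-identityˡ w))
    π : Permutation N N
    π = permute enumeration (1# +_) (- 1# +_) +-congˡ +-congˡ
          (cancel (-‿inverseʳ 1#)) (cancel (-‿inverseˡ 1#))

  private
    product≉0 : ∀ {n} (v : Vector Carrier n) → (∀ i → ¬ v i ≈ 0#) → ¬ ∏.sum v ≈ 0#
    product≉0 {zero}  v v≉0 = 1≉0
    product≉0 {suc n} v v≉0 = [ v≉0 zero , product≉0 (v ∘ suc) (v≉0 ∘ suc) ]′ ∘ x*y≈0⇒x≈0∨y≈0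

    -- The extra factor `x` takes the place of the exceptional entry 1. Multiplying by it yields the
    -- exponent `n` directly and avoids n - 1.
    product-constant-but-one : ∀ {n} x (v : Vector Carrier n) i → v i ≈ 1# →
      (∀ j → j ≢ i → v j ≈ x) → x * ∏.sum v ≈ x ^ᴷ n
    product-constant-but-one {suc n} x v i vi≈1 v≈x = *-congˡ (begin
      ∏.sum v                              ≈⟨ ∏.sum-remove v ⟩
      v i * ∏.sum (Vector.removeAt v i)    ≈⟨ *-cong vi≈1 (∏.sum-cong-≋ (λ j → v≈x _ (Fin.punchInᵢ≢i i j))) ⟩
      1# * ∏.sum (Vector.replicate n x)    ≈⟨ *-identityˡ _ ⟩
      ∏.sum (Vector.replicate n x)         ≈⟨ ∏.sum-replicate n ⟩
      x ^ᴷ n                               ∎)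

    select : Carrier → Carrier → Carrier → Carrier
    select x y z with z ≟ 0#
    ... | yes _ = x
    ... | no  _ = y

    select-0 : ∀ {x y z} → z ≈ 0# → select x y z ≈ x
    select-0 {z = z} z≈0 with z ≟ 0#
    ... | yes _   = refl
    ... | no  z≉0 = contradiction z≈0 z≉0

    select-≉0 : ∀ {x y z} → ¬ z ≈ 0# → select x y z ≈ y
    select-≉0 {z = z} z≉0 with z ≟ 0#
    ... | yes z≈0 = contradiction z≈0 z≉0
    ... | no  _   = refl

  -- Dilation by x ≠ 0 permutes the field. The product is taken over u, which replaces the
  -- factor 0 by 1; v collects the factors x that the dilation contributes.
  x^N≈x : ∀ x → x ^ᴷ N ≈ x
  x^N≈x x with x ≟ 0#
  ... | yes x≈0 = trans (^-congˡ N x≈0) (trans (0^n≈0 N (ℕ.<-trans ℕ.z<s 1<N)) (sym x≈0))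
  ... | no  x≉0 with invertible x≉0
  ...   | x⁻¹ , x⁻¹x≈1 , xx⁻¹≈1 = begin
      x ^ᴷ N                ≈⟨ product-constant-but-one x (v ∘ from) (to 0#)
                                 (select-0 (strictlyInverseʳ 0#))
                                 (λ j j≢ → select-≉0 (λ fj≈0 → j≢ (≡.trans (≡.sym (strictlyInverseˡ j)) (to-cong fj≈0)))) ⟨
      x * ∏.sum (v ∘ from)  ≈⟨ *-congˡ (*-cancelʳ-nonZero (product≉0 (u ∘ from) (λ _ → u≉0 _)) (begin
          ∏.sum (v ∘ from) * ∏.sum (u ∘ from)   ≈⟨ ∏.∑-distrib-+ (v ∘ from) (u ∘ from) ⟨
          ∏.sum (λ i → v (from i) * u (from i)) ≈⟨ ∏.sum-cong-≋ (λ i → u-dilate (from i)) ⟨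
          ∏.sum (λ i → u (x * from i))          ≈⟨ ∏.sum-cong-≋ (λ i → u-cong (strictlyInverseʳ (x * from i))) ⟨
          ∏.sum (λ i → u (from (π ⟨$⟩ʳ i)))     ≈⟨ ∏.sum-permute (u ∘ from) π ⟨
          ∏.sum (u ∘ from)                      ≈⟨ *-identityˡ _ ⟨
          1# * ∏.sum (u ∘ from)                 ∎)) ⟩
      x * 1#                ≈⟨ *-identityʳ x ⟩
      x                     ∎
    where
    u v : Carrier → Carrier
    u z = select 1# z z
    v z = select 1# x z
    u-cong : ∀ {y z} → y ≈ z → u y ≈ u z
    u-cong {y} {z} y≈z with z ≟ 0#
    ... | yes z≈0 = select-0 (trans y≈z z≈0)
    ... | no  z≉0 = trans (select-≉0 (λ y≈0 → z≉0 (trans (sym y≈z) y≈0))) y≈z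
    u≉0 : ∀ z → ¬ u z ≈ 0#
    u≉0 z with z ≟ 0#
    ... | yes _   = 1≉0
    ... | no  z≉0 = z≉0
    u-dilate : ∀ z → u (x * z) ≈ v z * u z
    u-dilate z with z ≟ 0#
    ... | yes z≈0 = trans (select-0 (trans (*-congˡ z≈0) (zeroʳ x))) (sym (*-identityˡ 1#))
    ... | no  z≉0 = select-≉0 ([ x≉0 , z≉0 ]′ ∘ x*y≈0⇒x≈0∨y≈0)
    cancel : ∀ {y z} → y * z ≈ 1# → ∀ w → y * (z * w) ≈ w
    cancel yz≈1 w = trans (sym (*-assoc _ _ _)) (trans (*-congʳ yz≈1) (*-identityˡ w))
    π : Permutation N N
    π = permute enumeration (x *_) (x⁻¹ *_) *-congˡ *-congˡ (cancel xx⁻¹≈1) (cancel x⁻¹x≈1)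

  x^[N∸1]≈1 : ∀ {x} → ¬ x ≈ 0# → x ^ᴷ (N ∸ 1) ≈ 1#
  x^[N∸1]≈1 {x} x≉0 = *-cancelʳ-nonZero x≉0 (begin
    x ^ᴷ (N ∸ 1) * x ≈⟨ *-comm _ x ⟩
    x ^ᴷ suc (N ∸ 1) ≈⟨ ^-congʳ x 1+[N∸1]≡N ⟩
    x ^ᴷ N           ≈⟨ x^N≈x x ⟩
    x                ≈⟨ *-identityˡ x ⟨
    1# * x           ∎)

  -- N · 1 = 0 is a product of s copies of p · 1 in a ring without zero divisors, so one of them
  -- vanishes; s = 0 would give 1 = 0.
  p·1≈0 : ∀ p s → N ≡ p ^ s → p · 1# ≈ 0#
  p·1≈0 p s N≡p^s = descend s (trans (×-congˡ (≡.sym N≡p^s)) N·1≈0)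
    where
    descend : ∀ s → (p ^ s) · 1# ≈ 0# → p · 1# ≈ 0#
    descend zero    1·1≈0 = contradiction (trans (sym (×-homo-1 1#)) 1·1≈0) 1≉0
    descend (suc s) eq    = [ (λ p·1≈0 → p·1≈0) , descend s ]′
      (x*y≈0⇒x≈0∨y≈0 (trans (sym (×1-homo-* p (p ^ s))) eq))

  -- Dividing by the root `r zero` lowers the degree, keeps the leading coefficient, and leaves the
  -- other d roots as roots of the quotient. At degree 0 one root remains, and it forces the
  -- constant to vanish.
  top≈0 : ∀ {d l f} → HasTop d l f → (r : Fin (suc d) → Carrier) →
          (∀ {i j} → r i ≈ r j → i ≡ j) → (∀ i → f (r i) ≈ 0#) → l ≈ 0#
  top≈0 (constant f≈l) r _ f≈0 = trans (sym (f≈l (r zero))) (f≈0 zero)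
  top≈0 {f = f} H@(horner _ _ _) r r-injective f≈0 with divide H (r zero)
  ... | h , H′ , f≈ = top≈0 H′ (r ∘ suc) (Fin.suc-injective ∘ r-injective) h≈0
    where
    h≈0 : ∀ i → h (r (suc i)) ≈ 0#
    h≈0 i with h (r (suc i)) ≟ 0#
    ... | yes eq = eq
    -- If the quotient did not vanish at this root, cancelling it would identify the root with
    -- `r zero`.
    ... | no  h≉0 = contradiction (r-injective (*-cancelʳ-nonZero h≉0 (begin
      r zero * h x              ≈⟨ +-identityˡ _ ⟨
      0# + r zero * h x         ≈⟨ +-congʳ (f≈0 (suc i)) ⟨
      f x + r zero * h x        ≈⟨ f≈ x ⟩
      x * h x + f (r zero)      ≈⟨ +-congˡ (f≈0 zero) ⟩
      x * h x + 0#              ≈⟨ +-identityʳ _ ⟩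
      x * h x                   ∎))) λ ()
      where x = r (suc i)

  -- If d < N, the first d + 1 elements of the enumeration are too many distinct roots.
  vanishing⇒N≤degree : ∀ {d l f} → HasTop d l f → ¬ l ≈ 0# → (∀ x → f x ≈ 0#) → N ≤ d
  vanishing⇒N≤degree {d} H l≉0 f≈0 = ℕ.≮⇒≥ λ d<N → l≉0 (top≈0 H
    (λ i → from (Fin.inject≤ i d<N))
    (λ eq → Fin.inject≤-injective d<N d<N _ _ (enumerate-injective enumeration eq))
    (λ _ → f≈0 _))

  hasTop-x^d-x : ∀ {d} → 1 < d → HasTop d 1# (λ x → x ^ᴷ d - x)
  hasTop-x^d-x {d} 1<d = hasTop-resp (+-identityʳ 1#) (λ _ → refl)
    (hasTop-+ (hasTop-^ d) (hasTop-< 1<d (horner (λ _ → - 1#) (constant (λ _ → refl)) λ x → begin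
      - x            ≈⟨ -1*x≈-x x ⟨
      - 1# * x       ≈⟨ *-comm _ x ⟩
      x * - 1#       ≈⟨ +-identityʳ _ ⟨
      x * - 1# + 0#  ∎)))
    where open RingProperties ring using (-1*x≈-x)

  -- Power maps on a finite field

  x^m≈1⇒x^[k*m]≈1 : ∀ m {x} → x ^ᴷ m ≈ 1# → ∀ k → x ^ᴷ (k ℕ.* m) ≈ 1#
  x^m≈1⇒x^[k*m]≈1 m {x} x^m≈1 k = begin
    x ^ᴷ (k ℕ.* m)  ≈⟨ ^-congʳ x (ℕ.*-comm k m) ⟩
    x ^ᴷ (m ℕ.* k)  ≈⟨ ^-assocʳ x m k ⟨
    (x ^ᴷ m) ^ᴷ k   ≈⟨ ^-congˡ k x^m≈1 ⟩
    1# ^ᴷ k         ≈⟨ 1^n≈1 k ⟩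
    1#              ∎

  -- Bézout over the naturals takes the form 1 + jn = im or 1 + im = jn; this is how such an
  -- equation is used without negative exponents.
  consecutive-exponents : ∀ {k l x} → suc k ≡ l → x ^ᴷ k ≈ 1# → x ^ᴷ l ≈ 1# → x ≈ 1#
  consecutive-exponents {x = x} ≡.refl x^k≈1 x^l≈1 =
    trans (sym (*-identityʳ x)) (trans (*-congˡ (sym x^k≈1)) x^l≈1)

  coprime-exponents : ∀ m n {x} → gcd m n ≡ 1 → x ^ᴷ m ≈ 1# → x ^ᴷ n ≈ 1# → x ≈ 1#
  coprime-exponents m n gcd≡1 x^m≈1 x^n≈1
    with Bézout.identity (≡.subst (GCD m n) gcd≡1 (gcd-GCD m n))
  ... | Bézout.Identity.+- i j eq =
    consecutive-exponents eq (x^m≈1⇒x^[k*m]≈1 n x^n≈1 j) (x^m≈1⇒x^[k*m]≈1 m x^m≈1 i)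
  ... | Bézout.Identity.-+ i j eq =
    consecutive-exponents eq (x^m≈1⇒x^[k*m]≈1 m x^m≈1 i) (x^m≈1⇒x^[k*m]≈1 n x^n≈1 j)

  -- The ratio r = x/y satisfies r^M = 1 because m divides M, and r^(N-1) = 1 because r is nonzero.
  -- The detour through M lets a single gcd condition on the product serve every exponent mᵢ.
  power-injective : ∀ {m M} → gcd M (N ∸ 1) ≡ 1 → m ∣ M → 0 < m →
                    ∀ {x y} → x ^ᴷ m ≈ y ^ᴷ m → x ≈ y
  power-injective {m} {M} coprime (divides k ≡.refl) 0<m {x} {y} x^m≈y^m with y ≟ 0#
  ... | yes y≈0 = trans (x^n≈0⇒x≈0 m (trans x^m≈y^m (trans (^-congˡ m y≈0) (0^n≈0 m 0<m)))) (sym y≈0)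
  ... | no  y≉0 with invertible y≉0
  ...   | y⁻¹ , y⁻¹y≈1 , yy⁻¹≈1 = begin
      x             ≈⟨ *-identityʳ x ⟨
      x * 1#        ≈⟨ *-congˡ y⁻¹y≈1 ⟨
      x * (y⁻¹ * y) ≈⟨ *-assoc x y⁻¹ y ⟨
      r * y         ≈⟨ *-congʳ (coprime-exponents M (N ∸ 1) coprime (x^m≈1⇒x^[k*m]≈1 m r^m≈1 k) (x^[N∸1]≈1 r≉0)) ⟩
      1# * y        ≈⟨ *-identityˡ y ⟩
      y             ∎
    where
    r = x * y⁻¹
    r^m≈1 : r ^ᴷ m ≈ 1#
    r^m≈1 = begin
      (x * y⁻¹) ^ᴷ m     ≈⟨ ^-distrib-* x y⁻¹ m ⟩
      x ^ᴷ m * y⁻¹ ^ᴷ m  ≈⟨ *-congʳ x^m≈y^m ⟩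
      y ^ᴷ m * y⁻¹ ^ᴷ m  ≈⟨ ^-distrib-* y y⁻¹ m ⟨
      (y * y⁻¹) ^ᴷ m     ≈⟨ ^-congˡ m yy⁻¹≈1 ⟩
      1# ^ᴷ m            ≈⟨ 1^n≈1 m ⟩
      1#                 ∎
    r≉0 : ¬ r ≈ 0#
    r≉0 r≈0 = 1≉0 (trans (sym r^m≈1) (trans (^-congˡ m r≈0) (0^n≈0 m 0<m)))

  -- If d = gcd M (N − 1) and N − 1 = d e, then every M-th power y satisfies y^(e+1) = y,
  -- so X^(e+1) − X has N roots as soon as every element is an M-th power.
  power-surjective⇒coprime : ∀ M → StrictlySurjective _≈_ (_^ᴷ M) → gcd M (N ∸ 1) ≡ 1
  power-surjective⇒coprime M surjective
    with gcd M (N ∸ 1) | gcd[m,n]∣m M (N ∸ 1) | gcd[m,n]∣n M (N ∸ 1)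
  ... | zero          | _           | divides e N∸1≡e0 =
        contradiction (≡.trans N∸1≡e0 (ℕ.*-zeroʳ e)) (ℕ.m>n⇒m∸n≢0 1<N)
  ... | d             | _           | divides zero N∸1≡0 = contradiction N∸1≡0 (ℕ.m>n⇒m∸n≢0 1<N)
  ... | suc zero      | _           | _ = ≡.refl
  ... | d@(suc (suc d′)) | divides k ≡.refl | divides e@(suc e′) N∸1≡ed =
        contradiction (ℕ.*-cancelˡ-≤ e (≡.subst₂ _≤_ N∸1≡ed (≡.sym (ℕ.*-identityʳ e)) N∸1≤e)) (ℕ.<⇒≱ (s≤s (s≤s z≤n)))
    where
    y^[1+e]≈y : ∀ y → y ^ᴷ suc e ≈ y
    y^[1+e]≈y y with surjective y
    ... | x , x^kd≈y = begin
      y ^ᴷ suc e                         ≈⟨ ^-congˡ (suc e) z^d≈y ⟨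
      (z ^ᴷ d) ^ᴷ suc e                  ≈⟨ *-congˡ (^-assocʳ z d e) ⟩
      z ^ᴷ d * z ^ᴷ (d ℕ.* e)            ≈⟨ *-congˡ (^-congʳ z (≡.trans (ℕ.*-comm d e) (≡.sym N∸1≡ed))) ⟩
      z * z ^ᴷ suc d′ * z ^ᴷ (N ∸ 1)     ≈⟨ solve 3 (λ z u v → z :* u :* v := z :* v :* u) refl z _ _ ⟩
      z ^ᴷ suc (N ∸ 1) * z ^ᴷ suc d′     ≈⟨ *-congʳ (^-congʳ z 1+[N∸1]≡N) ⟩
      z ^ᴷ N * z ^ᴷ suc d′               ≈⟨ *-congʳ (x^N≈x z) ⟩
      z ^ᴷ d                             ≈⟨ z^d≈y ⟩
      y                                  ∎
      where
      z = x ^ᴷ k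
      z^d≈y : z ^ᴷ d ≈ y
      z^d≈y = trans (^-assocʳ x k d) x^kd≈y
    N∸1≤e : N ∸ 1 ≤ e
    N∸1≤e = ℕ.∸-monoˡ-≤ 1 (vanishing⇒N≤degree (hasTop-x^d-x (s≤s (s≤s z≤n))) 1≉0
      (λ y → trans (+-congʳ (y^[1+e]≈y y)) (-‿inverseʳ y)))

  -- The power map of the product is the composite of the individual ones, so the gcd with the whole
  -- product can be treated at once.
  ∏-power-surjective : ∀ {n} (m : Vector ℕ n) → (∀ i → StrictlySurjective _≈_ (_^ᴷ m i)) →
                       StrictlySurjective _≈_ (_^ᴷ ∏ m)
  ∏-power-surjective {zero}  m surjective y = y , *-identityʳ y
  ∏-power-surjective {suc n} m surjective y with surjective zero y
  ... | x , x^m₀≈y with ∏-power-surjective (m ∘ suc) (surjective ∘ suc) x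
  ...   | z , z^∏≈x = z , (begin
      z ^ᴷ (m zero ℕ.* ∏ (m ∘ suc))  ≈⟨ ^-congʳ z (ℕ.*-comm (m zero) _) ⟩
      z ^ᴷ (∏ (m ∘ suc) ℕ.* m zero)  ≈⟨ ^-assocʳ z (∏ (m ∘ suc)) (m zero) ⟨
      (z ^ᴷ ∏ (m ∘ suc)) ^ᴷ m zero   ≈⟨ ^-congˡ (m zero) z^∏≈x ⟩
      x ^ᴷ m zero                    ≈⟨ x^m₀≈y ⟩
      y                              ∎)

mᵢ∣∏m : ∀ {n} (m : Vector ℕ n) i → m i ∣ ∏ m
mᵢ∣∏m m zero    = m∣m*n (∏ (m ∘ suc))
mᵢ∣∏m m (suc i) = ∣n⇒∣m*n (m zero) (mᵢ∣∏m (m ∘ suc) i)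

-- The trace

module Trace
  {p s q n : ℕ} (0<n : 0 < n) (p-prime : Prime p) (q≡p^s : q ≡ p ^ s)
  (k : CommutativeRing a ℓ₁) (K : CommutativeRing b ℓ₂)
  (φ : CommutativeRing.Carrier k → CommutativeRing.Carrier K)
  (k-finite : IsFiniteField k q) (K-finite : IsFiniteField K (q ^ n))
  (extension : Extension.IsExtension k K φ)
  where

  private
    module k = CommutativeRing k
    module k^ = Exp k.commutativeSemiring
    module 𝔽q = FiniteField k k-finite
    module 𝔽qⁿ = FiniteField K K-finite
    module E = Inverse (IsFiniteField.enumeration k-finite)

  open CommutativeRing K hiding (zero)
  open SemiringSum semiring using (sum; sum-cong-≋; sum-init-last)
  open MonoidSum +-commutativeMonoid using (∑-distrib-+; sum-remove; sum-replicate-zero)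
  open Exp commutativeSemiring renaming (_^_ to _^ᴷ_)
  open AbelianGroupProperties +-abelianGroup using (identityˡ-unique; ∙-cancelˡ)
  open Polynomial K hiding (Tr)
  open PolynomialFunctions K
  open Extension k K φ
  open RingMorphisms.IsRingHomomorphism extension
    using (⟦⟧-cong; +-homo; *-homo; 0#-homo; 1#-homo; -‿homo)
  open SetoidReasoning setoid

  -- If c - d were nonzero it would be invertible, and its image 0 would be invertible as well.
  φ-injective : Injective k._≈_ _≈_ φ
  φ-injective {c} {d} φc≈φd with c k.- d 𝔽q.≟ k.0#
  ... | yes c-d≈0 = RingProperties.x∙y⁻¹≈ε⇒x≈y k.ring c d c-d≈0
  ... | no  c-d≉0 with IsField.invertible (IsFiniteField.isField k-finite) c-d≉0
  ...   | e , _ , [c-d]e≈1 = contradiction (begin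
      1#                   ≈⟨ 1#-homo ⟨
      φ k.1#               ≈⟨ ⟦⟧-cong [c-d]e≈1 ⟨
      φ ((c k.- d) k.* e)  ≈⟨ *-homo _ e ⟩
      φ (c k.- d) * φ e    ≈⟨ *-congʳ (+-homo c (k.- d)) ⟩
      (φ c + φ (k.- d)) * φ e  ≈⟨ *-congʳ (+-cong φc≈φd (-‿homo d)) ⟩
      (φ d - φ d) * φ e    ≈⟨ *-congʳ (-‿inverseʳ (φ d)) ⟩
      0# * φ e             ≈⟨ zeroˡ _ ⟩
      0#                   ∎) (IsField.1≉0 (IsFiniteField.isField K-finite))

  φ-^ : ∀ c m → φ (c k^.^ m) ≈ φ c ^ᴷ m
  φ-^ c zero    = 1#-homo
  φ-^ c (suc m) = trans (*-homo c _) (*-congˡ (φ-^ c m))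

  φc^q≈φc : ∀ c → φ c ^ᴷ q ≈ φ c
  φc^q≈φc c = trans (sym (φ-^ c q)) (⟦⟧-cong (𝔽q.x^N≈x c))

  -- The q elements of φ(`k`) are already roots of X^q - X; another root `x` would be one too many
  -- for the degree. A finite search decides whether `x` is among them.
  x^q≈x⇒x∈φ : ∀ x → x ^ᴷ q ≈ x → ∃ λ c → φ c ≈ x
  x^q≈x⇒x∈φ x x^q≈x with Fin.any? (λ i → φ (E.from i) 𝔽qⁿ.≟ x)
  ... | yes (i , φi≈x) = E.from i , φi≈x
  ... | no  ∄i = contradiction
      (𝔽qⁿ.top≈0 (𝔽qⁿ.hasTop-x^d-x 𝔽q.1<N) root root-injective root-vanishes)
      (IsField.1≉0 (IsFiniteField.isField K-finite))
    where
    root : Fin (suc q) → Carrier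
    root zero    = x
    root (suc i) = φ (E.from i)
    root-injective : ∀ {i j} → root i ≈ root j → i ≡ j
    root-injective {zero}  {zero}  eq = ≡.refl
    root-injective {zero}  {suc j} eq = contradiction (j , sym eq) ∄i
    root-injective {suc i} {zero}  eq = contradiction (i , eq) ∄i
    root-injective {suc i} {suc j} eq =
      ≡.cong suc (enumerate-injective (IsFiniteField.enumeration k-finite) (φ-injective eq))
    root-vanishes : ∀ i → root i ^ᴷ q - root i ≈ 0#
    root-vanishes zero    = trans (+-congʳ x^q≈x) (-‿inverseʳ _)
    root-vanishes (suc i) = trans (+-congʳ (φc^q≈φc _)) (-‿inverseʳ _)

  frobenius : ∀ j x y → (x + y) ^ᴷ (q ^ j) ≈ x ^ᴷ (q ^ j) + y ^ᴷ (q ^ j)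
  frobenius j x y = begin
    (x + y) ^ᴷ (q ^ j)                   ≈⟨ ^-congʳ (x + y) q^j≡ ⟩
    (x + y) ^ᴷ (p ^ (s ℕ.* j))           ≈⟨ Characteristic.frobenius^-+ K p-prime p·1≈0 (s ℕ.* j) x y ⟩
    x ^ᴷ (p ^ (s ℕ.* j)) + y ^ᴷ (p ^ (s ℕ.* j)) ≈⟨ +-cong (^-congʳ x q^j≡) (^-congʳ y q^j≡) ⟨
    x ^ᴷ (q ^ j) + y ^ᴷ (q ^ j)          ∎
    where
    q^≡p^ : ∀ j → q ^ j ≡ p ^ (s ℕ.* j)
    q^≡p^ j = ≡.trans (≡.cong (_^ j) q≡p^s) (ℕ.^-*-assoc p s j)
    q^j≡ = q^≡p^ j
    -- `K` has q^n = p^(sn) elements, which fixes its characteristic.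
    p·1≈0 = 𝔽qⁿ.p·1≈0 p (s ℕ.* n) (q^≡p^ n)

  conjugate : Carrier → ℕ → Carrier
  conjugate x j = x ^ᴷ (q ^ j)

  trace : Carrier → Carrier
  trace x = sum {n} (λ j → conjugate x (toℕ j))

  trace-cong : ∀ {x y} → x ≈ y → trace x ≈ trace y
  trace-cong x≈y = sum-cong-≋ {n} (λ j → ^-congˡ (q ^ toℕ j) x≈y)

  trace-+ : ∀ x y → trace (x + y) ≈ trace x + trace y
  trace-+ x y = trans (sum-cong-≋ {n} (λ j → frobenius (toℕ j) x y)) (∑-distrib-+ {n} (conjugate x ∘ toℕ) (conjugate y ∘ toℕ))

  conjugate-φ : ∀ c j → conjugate (φ c) j ≈ φ c
  conjugate-φ c zero    = *-identityʳ _
  conjugate-φ c (suc j) = begin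
    φ c ^ᴷ (q ℕ.* q ^ j)   ≈⟨ ^-assocʳ (φ c) q (q ^ j) ⟨
    (φ c ^ᴷ q) ^ᴷ (q ^ j)  ≈⟨ ^-congˡ (q ^ j) (φc^q≈φc c) ⟩
    φ c ^ᴷ (q ^ j)         ≈⟨ conjugate-φ c j ⟩
    φ c                    ∎

  trace-φ* : ∀ c x → trace (φ c * x) ≈ φ c * trace x
  trace-φ* c x = begin
    sum {n} (λ j → conjugate (φ c * x) (toℕ j))
      ≈⟨ sum-cong-≋ {n} (λ j → trans (^-distrib-* (φ c) x (q ^ toℕ j)) (*-congʳ (conjugate-φ c (toℕ j)))) ⟩
    sum {n} (λ j → φ c * conjugate x (toℕ j))
      ≈⟨ SemiringSum.*-distribˡ-sum semiring {n} (φ c) (conjugate x ∘ toℕ) ⟨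
    φ c * trace x ∎

  trace-0 : trace 0# ≈ 0#
  trace-0 = identityˡ-unique _ _ (trans (sym (trace-+ 0# 0#)) (trace-cong (+-identityʳ 0#)))

  -- Carries information about the traces Tr(vᵢx) over to the span of the vᵢ. The length is
  -- quantified anew, separately from the degree that `trace` fixes, so that induction on it is
  -- possible.
  trace-linearCombination : ∀ {n} (c : Vector k.Carrier n) (v : Vector Carrier n) x →
    trace (linearCombination c v * x) ≈ linearCombination c (λ i → trace (v i * x))
  trace-linearCombination {zero}  c v x = trans (trace-cong (zeroˡ x)) trace-0
  trace-linearCombination {suc n} c v x = begin
    trace ((φ (c zero) * v zero + rest) * x)
      ≈⟨ trace-cong (trans (distribʳ x _ rest) (+-congʳ (*-assoc _ _ x))) ⟩
    trace (φ (c zero) * (v zero * x) + rest * x)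
      ≈⟨ trace-+ _ _ ⟩
    trace (φ (c zero) * (v zero * x)) + trace (rest * x)
      ≈⟨ +-cong (trace-φ* _ _) (trace-linearCombination (c ∘ suc) (v ∘ suc) x) ⟩
    linearCombination c (λ i → trace (v i * x)) ∎
    where rest = linearCombination (c ∘ suc) (v ∘ suc)

  sum-^q : ∀ {m} (v : Vector Carrier m) → sum v ^ᴷ q ≈ sum (λ i → v i ^ᴷ q)
  sum-^q {zero}  v = 𝔽qⁿ.0^n≈0 q (ℕ.<-trans ℕ.z<s 𝔽q.1<N)
  sum-^q {suc m} v = trans (frobenius₁ _ _) (+-congˡ (sum-^q (v ∘ suc)))
    where
    q^1≡q = ℕ.^-identityʳ q
    frobenius₁ : ∀ x y → (x + y) ^ᴷ q ≈ x ^ᴷ q + y ^ᴷ q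
    frobenius₁ x y = trans (^-congʳ (x + y) (≡.sym q^1≡q))
      (trans (frobenius 1 x y) (+-cong (^-congʳ x q^1≡q) (^-congʳ y q^1≡q)))

  -- After adding `u 0`, both sides are the sum of u over 0, ..., m, split at its first and at its
  -- last term.
  sum-shift : ∀ m (u : ℕ → Carrier) → u m ≈ u 0 →
              sum {m} (λ i → u (suc (toℕ i))) ≈ sum {m} (u ∘ toℕ)
  sum-shift m u um≈u0 = ∙-cancelˡ (u 0) _ _ (begin
    sum {suc m} (u ∘ toℕ)                             ≈⟨ sum-init-last {m} (u ∘ toℕ) ⟩
    sum {m} (λ i → u (toℕ (inject₁ i))) + u (toℕ (fromℕ m))
      ≈⟨ +-cong (sum-cong-≋ {m} (λ i → reflexive (≡.cong u (Fin.toℕ-inject₁ i))))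
                (trans (reflexive (≡.cong u (Fin.toℕ-fromℕ m))) um≈u0) ⟩
    sum {m} (u ∘ toℕ) + u 0                           ≈⟨ +-comm _ _ ⟩
    u 0 + sum {m} (u ∘ toℕ)                           ∎)

  -- Raising to the power q moves each conjugate to the next, and the last returns to the first
  -- because x^(q^n) = x.
  trace^q≈trace : ∀ x → trace x ^ᴷ q ≈ trace x
  trace^q≈trace x = begin
    trace x ^ᴷ q                                 ≈⟨ sum-^q {n} (conjugate x ∘ toℕ) ⟩
    sum {n} (λ j → conjugate x (toℕ j) ^ᴷ q)     ≈⟨ sum-cong-≋ {n} (λ j → conjugate^q (toℕ j)) ⟩
    sum {n} (λ j → conjugate x (suc (toℕ j)))
      ≈⟨ sum-shift n (conjugate x) (trans (𝔽qⁿ.x^N≈x x) (sym (*-identityʳ x))) ⟩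
    trace x                                      ∎
    where
    conjugate^q : ∀ j → conjugate x j ^ᴷ q ≈ conjugate x (suc j)
    conjugate^q j = trans (^-assocʳ x (q ^ j) q) (^-congʳ x (ℕ.*-comm (q ^ j) q))

  -- The trace as an element of `k`: coefficient vectors live over `k`, whereas `trace` has values
  -- in `K`.
  tr : Carrier → k.Carrier
  tr x = proj₁ (x^q≈x⇒x∈φ (trace x) (trace^q≈trace x))

  φ∘tr : ∀ x → φ (tr x) ≈ trace x
  φ∘tr x = proj₂ (x^q≈x⇒x∈φ (trace x) (trace^q≈trace x))

  -- Only the last conjugate reaches the top degree; since 1 < q, the earlier exponents are strictly
  -- smaller and contribute zero there.
  hasTop-trace : ∀ n → 0 < n →
    HasTop (q ^ ℕ.pred n) 1# (λ x → sum {n} (λ j → conjugate x (toℕ j)))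
  hasTop-trace (suc n) _ = hasTop-resp (+-identityˡ 1#)
    (λ x → trans (+-congˡ (reflexive (≡.cong (conjugate x) (≡.sym (Fin.toℕ-fromℕ n)))))
                 (sym (sum-init-last {n} (conjugate x ∘ toℕ))))
    (hasTop-+ (hasTop-sum {n = n} _ (λ j → hasTop-<
      (ℕ.^-monoʳ-< q 𝔽q.1<N (≡.subst (_< n) (≡.sym (Fin.toℕ-inject₁ j)) (Fin.toℕ<n j)))
      (hasTop-^ (q ^ toℕ (inject₁ j))))) (hasTop-^ (q ^ n)))

  trace≉0 : ¬ (∀ x → trace x ≈ 0#)
  trace≉0 trace≈0 = ℕ.<⇒≱ (ℕ.^-monoʳ-< q 𝔽q.1<N pred[n]<n)
    (𝔽qⁿ.vanishing⇒N≤degree (hasTop-trace n 0<n)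
      (IsField.1≉0 (IsFiniteField.isField K-finite)) trace≈0)
    where
    pred[n]<n : ℕ.pred n < n
    pred[n]<n = ℕ.≤-reflexive (ℕ.suc-pred n {{ℕ.>-nonZero 0<n}})

  -- If x were invertible, every y would have the form zx with z = y/x, and the trace would vanish
  -- identically.
  trace-nondegenerate : ∀ {x} → (∀ z → trace (z * x) ≈ 0#) → x ≈ 0#
  trace-nondegenerate {x} trace≈0 with x 𝔽qⁿ.≟ 0#
  ... | yes x≈0 = x≈0
  ... | no  x≉0 with IsField.invertible (IsFiniteField.isField K-finite) x≉0
  ...   | x⁻¹ , x⁻¹x≈1 , _ = contradiction (λ y → begin
      trace y               ≈⟨ trace-cong (*-identityʳ y) ⟨
      trace (y * 1#)        ≈⟨ trace-cong (*-congˡ x⁻¹x≈1) ⟨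
      trace (y * (x⁻¹ * x)) ≈⟨ trace-cong (*-assoc y x⁻¹ x) ⟨
      trace (y * x⁻¹ * x)   ≈⟨ trace≈0 (y * x⁻¹) ⟩
      0#                    ∎) trace≉0

  -- Linear combinations and bases

  linearCombination-cong : ∀ {n} {c d : Vector k.Carrier n} (v : Vector Carrier n) →
    (∀ i → c i k.≈ d i) → linearCombination c v ≈ linearCombination d v
  linearCombination-cong v c≈d = sum-cong-≋ (λ i → *-congʳ (⟦⟧-cong (c≈d i)))

  linearCombination-+ : ∀ {n} (c d : Vector k.Carrier n) (v : Vector Carrier n) →
    linearCombination (λ i → c i k.+ d i) v ≈ linearCombination c v + linearCombination d v
  linearCombination-+ c d v = trans
    (sum-cong-≋ (λ i → trans (*-congʳ (+-homo (c i) (d i))) (distribʳ (v i) (φ (c i)) (φ (d i)))))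
    (∑-distrib-+ (λ i → φ (c i) * v i) (λ i → φ (d i) * v i))

  linearCombination-0 : ∀ {n} (v : Vector Carrier n) → linearCombination (λ _ → k.0#) v ≈ 0#
  linearCombination-0 {n} v =
    trans (sum-cong-≋ (λ i → trans (*-congʳ 0#-homo) (zeroˡ (v i)))) (sum-replicate-zero n)

  -- Pairing with a unit vector reads off one coefficient. In the independence proof for θ, the unit
  -- vector arises as a vector of traces.
  linearCombination-unit : ∀ {n} (c e : Vector k.Carrier n) j → e j k.≈ k.1# →
    (∀ i → i ≢ j → e i k.≈ k.0#) → linearCombination c (φ ∘ e) ≈ φ (c j)
  linearCombination-unit {suc n} c e j ej≈1 e≈0 = begin
    linearCombination c (φ ∘ e)
      ≈⟨ sum-remove {i = j} (λ i → φ (c i) * φ (e i)) ⟩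
    φ (c j) * φ (e j) + sum (Vector.removeAt (λ i → φ (c i) * φ (e i)) j)
      ≈⟨ +-cong (trans (*-congˡ (trans (⟦⟧-cong ej≈1) 1#-homo)) (*-identityʳ _))
                (trans (sum-cong-≋ {n} (λ i → trans
                         (*-congˡ (trans (⟦⟧-cong (e≈0 _ (Fin.punchInᵢ≢i j i))) 0#-homo)) (zeroʳ _)))
                       (sum-replicate-zero n)) ⟩
    φ (c j) + 0#   ≈⟨ +-identityʳ _ ⟩
    φ (c j)        ∎

  independent⇒injective : ∀ {n} (v : Vector Carrier n) →
    (∀ c → linearCombination c v ≈ 0# → ∀ i → c i k.≈ k.0#) →
    ∀ c d → linearCombination c v ≈ linearCombination d v → ∀ i → c i k.≈ d i
  independent⇒injective v independent c d cv≈dv i =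
    RingProperties.x∙y⁻¹≈ε⇒x≈y k.ring (c i) (d i) (independent (λ i → c i k.- d i)
      (identityˡ-unique _ _ (begin
        linearCombination (λ i → c i k.- d i) v + linearCombination d v
          ≈⟨ linearCombination-+ (λ i → c i k.- d i) d v ⟨
        linearCombination (λ i → (c i k.- d i) k.+ d i) v
          ≈⟨ linearCombination-cong v (λ i → k.trans (k.+-assoc _ _ _)
               (k.trans (k.+-congˡ (k.-‿inverseˡ (d i))) (k.+-identityʳ (c i)))) ⟩
        linearCombination c v
          ≈⟨ cv≈dv ⟩
        linearCombination d v ∎)) i)

  private
    module kⁿ = Setoid (VectorEquality.≋-setoid k.setoid n)
    enumeration-K  = IsFiniteField.enumeration K-finite
    enumeration-kⁿ = vectorEnumeration (IsFiniteField.enumeration k-finite) n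

  -- Coefficient vectors and elements of `K` are equally many, q^n, so a surjective combination map
  -- is injective; the next lemma uses the converse direction.
  spanning⇒basis : (v : Vector Carrier n) → (∀ x → ∃ λ c → linearCombination c v ≈ x) → IsBasis v
  spanning⇒basis v spanning = record
    { independent = λ c cv≈0 → strictlySurjective⇒injective enumeration-kⁿ enumeration-K
        (linearCombination-cong v) spanning (trans cv≈0 (sym (linearCombination-0 v)))
    ; spanning    = spanning
    }

  independent⇒basis : (v : Vector Carrier n) →
    (∀ c → linearCombination c v ≈ 0# → ∀ i → c i k.≈ k.0#) → IsBasis v
  independent⇒basis v independent = record
    { independent = independent
    ; spanning    = injective⇒strictlySurjective enumeration-kⁿ enumeration-K
        (λ {c} {d} → independent⇒injective v independent c d)
    }

  -- The polynomial F and the equivalence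

  module _ (θ α : Vector Carrier n) (m : Vector ℕ n) where

    traceMap : Carrier → Vector k.Carrier n
    traceMap x i = tr (θ i * x)

    powers : Carrier → Vector k.Carrier n
    powers x i = traceMap x i k^.^ m i

    F : Carrier → Carrier
    F = eval (traceForm q n α θ m)

    F≈linearCombination : ∀ x → F x ≈ linearCombination (powers x) α
    F≈linearCombination x = trans (eval-traceForm q n α θ m x) (sum-cong-≋ {n} (λ i → begin
      α i * trace (θ i * x) ^ᴷ m i   ≈⟨ *-comm _ _ ⟩
      trace (θ i * x) ^ᴷ m i * α i
        ≈⟨ *-congʳ (trans (φ-^ (traceMap x i) (m i)) (^-congˡ (m i) (φ∘tr (θ i * x)))) ⟨
      φ (powers x i) * α i           ∎))

    F-cong : Congruent _≈_ _≈_ F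
    F-cong = eval-cong (traceForm q n α θ m)

    traceMap-determines-F : ∀ {x y} → traceMap x kⁿ.≈ traceMap y → F x ≈ F y
    traceMap-determines-F {x} {y} eq = trans (F≈linearCombination x)
      (trans (linearCombination-cong α (λ i → k^.^-congˡ (m i) (eq i))) (sym (F≈linearCombination y)))

    module Sufficiency
      (m-positive : ∀ i → 0 < m i) (coprime : gcd (∏ m) (q ∸ 1) ≡ 1)
      (α-basis : IsBasis α) (θ-basis : IsBasis θ) where

      F-injective : Injective _≈_ _≈_ F
      F-injective {x} {y} Fx≈Fy = RingProperties.x∙y⁻¹≈ε⇒x≈y ring x y
        (trace-nondegenerate trace[z[x-y]]≈0)
        where
        powers-agree : powers x kⁿ.≈ powers y
        powers-agree = independent⇒injective α (IsBasis.independent α-basis) (powers x) (powers y)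
          (trans (sym (F≈linearCombination x)) (trans Fx≈Fy (F≈linearCombination y)))
        traces-agree : ∀ i → trace (θ i * x) ≈ trace (θ i * y)
        traces-agree i = trans (sym (φ∘tr _)) (trans
          (⟦⟧-cong (𝔽q.power-injective coprime (mᵢ∣∏m m i) (m-positive i) (powers-agree i))) (φ∘tr _))
        trace[θᵢ[x-y]]≈0 : ∀ i → trace (θ i * (x - y)) ≈ 0#
        trace[θᵢ[x-y]]≈0 i = identityˡ-unique _ _ (begin
          trace (θ i * (x - y)) + trace (θ i * y) ≈⟨ trace-+ _ _ ⟨
          trace (θ i * (x - y) + θ i * y)         ≈⟨ trace-cong (distribˡ (θ i) (x - y) y) ⟨
          trace (θ i * (x - y + y))               ≈⟨ trace-cong (*-congˡ (trans (+-assoc x (- y) y)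
                                                       (trans (+-congˡ (-‿inverseˡ y)) (+-identityʳ x)))) ⟩
          trace (θ i * x)                         ≈⟨ traces-agree i ⟩
          trace (θ i * y)                         ∎)
        -- Since θ spans, vanishing against each θᵢ extends to every z, as nondegeneracy demands.
        trace[z[x-y]]≈0 : ∀ z → trace (z * (x - y)) ≈ 0#
        trace[z[x-y]]≈0 z with IsBasis.spanning θ-basis z
        ... | c , cθ≈z = begin
          trace (z * (x - y))                                  ≈⟨ trace-cong (*-congʳ cθ≈z) ⟨
          trace (linearCombination c θ * (x - y))              ≈⟨ trace-linearCombination c θ (x - y) ⟩
          linearCombination c (λ i → trace (θ i * (x - y)))
            ≈⟨ sum-cong-≋ {n} (λ i → trans (*-congˡ {φ (c i)} (trace[θᵢ[x-y]]≈0 i)) (zeroʳ _)) ⟩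
          sum {n} (λ _ → 0#)                                   ≈⟨ sum-replicate-zero n ⟩
          0#                                                   ∎

      permutes : IsPermutationPolynomial (traceForm q n α θ m)
      permutes = F-injective , Consequences.strictlySurjective⇒surjective setoid setoid F-cong
        (injective⇒strictlySurjective enumeration-K enumeration-K F-injective)

    module Necessity (permutes : IsPermutationPolynomial (traceForm q n α θ m)) where

      F-surjective : StrictlySurjective _≈_ F
      F-surjective y = proj₁ (proj₂ permutes y) , proj₂ (proj₂ permutes y) refl

      -- Every value of F is a combination of the αᵢ, so surjectivity of F makes them span.
      α-basis : IsBasis α
      α-basis = spanning⇒basis α λ x → powers (proj₁ (F-surjective x)) ,
        trans (sym (F≈linearCombination (proj₁ (F-surjective x)))) (proj₂ (F-surjective x))

      traceMap-surjective : StrictlySurjective kⁿ._≈_ traceMap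
      traceMap-surjective = injective⇒strictlySurjective enumeration-K enumeration-kⁿ
        (λ eq → proj₁ permutes (traceMap-determines-F eq))

      θ-basis : IsBasis θ
      θ-basis = independent⇒basis θ λ c cθ≈0 j →
        -- Choose x with Tr(θᵢx) equal to 1 for i = j and to 0 otherwise. Multiplying the relation
        -- among the θᵢ by x and taking the trace leaves only its j-th coefficient.
        let e = Vector.updateAt (λ _ → k.0#) j (λ _ → k.1#)
            x , traceMap-x≈e = traceMap-surjective e
        in φ-injective (begin
          φ (c j)
            ≈⟨ linearCombination-unit c e j (k.reflexive (updateAt-updates j (λ _ → k.0#)))
                 (λ i i≢j → k.reflexive (updateAt-minimal i j (λ _ → k.0#) i≢j)) ⟨
          linearCombination c (φ ∘ e)
            ≈⟨ sum-cong-≋ {n} (λ i → *-congˡ {φ (c i)} (trans (sym (⟦⟧-cong (traceMap-x≈e i))) (φ∘tr (θ i * x)))) ⟩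
          linearCombination c (λ i → trace (θ i * x))
            ≈⟨ trace-linearCombination c θ x ⟨
          trace (linearCombination c θ * x)
            ≈⟨ trace-cong (trans (*-congʳ cθ≈0) (zeroˡ x)) ⟩
          trace 0#
            ≈⟨ trace-0 ⟩
          0#
            ≈⟨ 0#-homo ⟨
          φ k.0# ∎)

      -- The target is the combination with all coefficients equal to c. Independence of α makes its
      -- coefficients unique, so the i-th coordinate of the powers at a preimage is c.
      power-surjective : ∀ i → StrictlySurjective k._≈_ (k^._^ m i)
      power-surjective i c with F-surjective (linearCombination (λ _ → c) α)
      ... | x , Fx≈cα = traceMap x i , independent⇒injective α (IsBasis.independent α-basis) (powers x) (λ _ → c)
        (trans (sym (F≈linearCombination x)) Fx≈cα) i

      coprime : gcd (∏ m) (q ∸ 1) ≡ 1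
      coprime = 𝔽q.power-surjective⇒coprime (∏ m) (𝔽q.∏-power-surjective m power-surjective)

    Permutes CoprimeAndBases : Set _
    Permutes        = IsPermutationPolynomial (traceForm q n α θ m)
    CoprimeAndBases = gcd (∏ m) (q ∸ 1) ≡ 1 × IsBasis α × IsBasis θ

    necessary : Permutes → CoprimeAndBases
    necessary permutes =
      Necessity.coprime permutes , Necessity.α-basis permutes , Necessity.θ-basis permutes

    sufficient : (∀ i → 0 < m i) → CoprimeAndBases → Permutes
    sufficient m-positive (coprime , α-basis , θ-basis) =
      Sufficiency.permutes m-positive coprime α-basis θ-basis

corollary1p1 : {a ℓ₁ b ℓ₂ : Level} (q n : ℕ) → IsPrimePower q → 0 < n →
    (k : CommutativeRing a ℓ₁) (K : CommutativeRing b ℓ₂)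
    (φ : CommutativeRing.Carrier k → CommutativeRing.Carrier K) →
    IsFiniteField k q → IsFiniteField K (q ^ n) →
    Extension.IsExtension k K φ →
    (θ α : Vector (CommutativeRing.Carrier K) n)
    (m : Vector ℕ n) → (∀ i → 0 < m i) →
    Polynomial.IsPermutationPolynomial K (Polynomial.traceForm K q n α θ m)
    ⇔ ( gcd (∏ m) (q ∸ 1) ≡ 1
    × Extension.IsBasis k K φ α
    × Extension.IsBasis k K φ θ )
corollary1p1 q n (p , s , p-prime , _ , q≡p^s) 0<n k K φ k-finite K-finite extension θ α m m-positive =
  mk⇔ (necessary θ α m) (sufficient θ α m m-positive)
  where open Trace {s = s} 0<n p-prime q≡p^s k K φ k-finite K-finite extension
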